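{- Let $a,b,c$ be positive real numbers and let $\{g_{n}^{(3)}(a,b,c;1)\}_{n\ge 0}$ be the geometric mean sequence defined by $g_{0}^{(3)}=a$, $g_{1}^{(3)}=b$, $g_{2}^{(3)}=c$ and $g_{n+3}^{(3)}=\sqrt[3]{g_{n+2}^{(3)}g_{n+1}^{(3)}g_{n}^{(3)}}$ for $n\ge 0$. Let $\{T_{n}^{(3)}\}_{n\ge 0}$ be the integer sequence defined by $T_{0}^{(3)}=T_{1}^{(3)}=0$, $T_{2}^{(3)}=1$ and $T_{n+3}^{(3)}=T_{n+2}^{(3)}+3T_{n+1}^{(3)}+9T_{n}^{(3)}$ for $n\ge 0$. Then for all $n\ge 0$, $$g_{n+2}^{(3)}(a,b,c;1)=\left(a^{T_{n+1}^{(3)}}\,b^{T_{n+1}^{(3)}+3T_{n}^{(3)}}\,c^{T_{n+2}^{(3)}}\right)^{3^{ -n}}.$$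
   Context: Cube roots and the fractional power $(\cdot)^{3^{ -n}}$ denote the positive real roots of positive real numbers. The superscript $(3)$ is part of the notation for the sequences, not an exponent. The last argument $1$ in $g_n^{(3)}(a,b,c;1)$ indicates that the scaling constant multiplying the cube root in the recurrence equals $1$. -}

module Defs where

open import Algebra.Bundles.Raw using (RawMonoid)
import Algebra.Definitions.RawMonoid as RawMonoidDefs
import Algebra.Definitions.RawSemiring as RawSemiringDefs
open import Data.Integer.Base as ℤ using (-[1+_])
import Data.Integer.Properties as ℤ
open import Data.Nat.Base as ℕ using (ℕ; zero; suc; NonZero)
import Data.Nat.Coprimality as Coprimality
open import Data.Product.Base using (∃-syntax; _×_; _,_)
open import Data.Rational.Base hiding (NonZero)
import Data.Rational.Base as ℚ using (NonZero)
open import Data.Rational.Properties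
open import Data.Rational.Solver using (module +-*-Solver)
import Data.Rational.Unnormalised.Base as ℚᵘ
import Data.Rational.Unnormalised.Properties as ℚᵘ
open import Data.Sum.Base using (_⊎_; inj₁; inj₂)
open import Level using (0ℓ) renaming (suc to lsuc)
open import Relation.Binary.Definitions using (tri<; tri≈; tri>)
open import Relation.Binary.PropositionalEquality
  using (_≡_; refl; sym; trans; cong; subst; subst₂)
open import Relation.Nullary.Decidable using (yes; no)
open import Relation.Nullary.Negation using (¬_; contradiction)
open import Relation.Unary using (Pred; _∈_; _≐_; Satisfiable)

open RawSemiringDefs +-*-rawSemiring public using (_^_)

-- Two-sided Dedekind cuts: q ∈ lower means q < x and q ∈ upper means x < q.

record ℝ : Set₁ where
  field
    lower upper     : Pred ℚ 0ℓ
    lower-inhabited : Satisfiable lower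
    upper-inhabited : Satisfiable upper
    lower-closed    : ∀ {q r} → q < r → r ∈ lower → q ∈ lower
    upper-closed    : ∀ {q r} → q < r → q ∈ upper → r ∈ upper
    lower-open      : ∀ {q} → q ∈ lower → ∃[ r ] q < r × r ∈ lower
    upper-open      : ∀ {r} → r ∈ upper → ∃[ q ] q < r × q ∈ upper
    disjoint        : ∀ {q} → ¬ (q ∈ lower × q ∈ upper)
    located         : ∀ {q r} → q < r → q ∈ lower ⊎ r ∈ upper

open ℝ public

infix 4 _≈_

_≈_ : ℝ → ℝ → Set
x ≈ y = (lower x ≐ lower y) × (upper x ≐ upper y)

record ℝ⁺ : Set₁ where
  constructor _,⁺_
  field
    real   : ℝ
    0<real : 0ℚ ∈ lower real

open ℝ⁺ public

infix 4 _≈⁺_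

_≈⁺_ : ℝ⁺ → ℝ⁺ → Set
x ≈⁺ y = real x ≈ real y

fromℕ : ℕ → ℚ
fromℕ n = mkℚ (ℤ.+ n) 0 (Coprimality.sym (Coprimality.1-coprimeTo n))

-- The arithmetic lemmas are opaque only because unfolding their proofs
-- inside `with` abstractions makes type checking very slow.

opaque

  *-mono-<-pos : ∀ {p q r s} → 0ℚ < p → 0ℚ < r → p < q → r < s → p * r < q * s
  *-mono-<-pos {p} {q} {r} {s} 0<p 0<r p<q r<s = <-trans
    (*-monoˡ-<-pos r {{positive 0<r}} p<q)
    (*-monoʳ-<-pos q {{positive (<-trans 0<p p<q)}} r<s)

  0<* : ∀ {p q} → 0ℚ < p → 0ℚ < q → 0ℚ < p * q
  0<* {p} {q} 0<p 0<q =
    subst (_< p * q) (*-zeroʳ p) (*-monoʳ-<-pos p {{positive 0<p}} 0<q)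

  0<1 : 0ℚ < 1ℚ
  0<1 = positive⁻¹ 1ℚ

  0<½ : 0ℚ < ½
  0<½ = positive⁻¹ ½

  0<^ : ∀ {p} n → 0ℚ < p → 0ℚ < p ^ n
  0<^ zero    0<p = 0<1
  0<^ (suc n) 0<p = 0<* 0<p (0<^ n 0<p)

  ^-monoˡ-≤-pos : ∀ {p q} n → 0ℚ < p → p ≤ q → p ^ n ≤ q ^ n
  ^-monoˡ-≤-pos         zero    0<p p≤q = ≤-refl
  ^-monoˡ-≤-pos {p} {q} (suc n) 0<p p≤q = ≤-trans
    (*-monoʳ-≤-nonNeg (p ^ n)
      {{nonNegative (<⇒≤ (0<^ n 0<p))}} p≤q)
    (*-monoˡ-≤-nonNeg q
      {{nonNegative (<⇒≤ (<-≤-trans 0<p p≤q))}} (^-monoˡ-≤-pos n 0<p p≤q))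

  ^-monoˡ-<-pos : ∀ {p q} n .{{_ : NonZero n}} → 0ℚ < p → p < q → p ^ n < q ^ n
  ^-monoˡ-<-pos {p} {q} (suc n) 0<p p<q = <-≤-trans
    (*-monoˡ-<-pos (p ^ n) {{positive (0<^ n 0<p)}} p<q)
    (*-monoˡ-≤-nonNeg q
      {{nonNegative (<⇒≤ (<-trans 0<p p<q))}} (^-monoˡ-≤-pos n 0<p (<⇒≤ p<q)))

  1^n≡1 : ∀ n → 1ℚ ^ n ≡ 1ℚ
  1^n≡1 zero    = refl
  1^n≡1 (suc n) = trans (*-identityˡ (1ℚ ^ n)) (1^n≡1 n)

  p^n≤p : ∀ {p} n .{{_ : NonZero n}} → 0ℚ < p → p ≤ 1ℚ → p ^ n ≤ p
  p^n≤p {p} (suc n) 0<p p≤1 = subst (p * p ^ n ≤_) (*-identityʳ p)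
    (*-monoˡ-≤-nonNeg p {{nonNegative (<⇒≤ 0<p)}}
      (subst (p ^ n ≤_) (1^n≡1 n) (^-monoˡ-≤-pos n 0<p p≤1)))

  p≤p^n : ∀ {p} n .{{_ : NonZero n}} → 1ℚ ≤ p → p ≤ p ^ n
  p≤p^n {p} (suc n) 1≤p = subst (_≤ p * p ^ n) (*-identityʳ p)
    (*-monoˡ-≤-nonNeg p {{nonNegative (≤-trans (<⇒≤ 0<1) 1≤p)}}
      (subst (_≤ p ^ n) (1^n≡1 n) (^-monoˡ-≤-pos n 0<1 1≤p)))

  p<p+q : ∀ {q} p → 0ℚ < q → p < p + q
  p<p+q {q} p 0<q = subst (_< p + q) (+-identityʳ p) (+-monoʳ-< p 0<q)

  p<q⇒0<q-p : ∀ {p q} → p < q → 0ℚ < q - p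
  p<q⇒0<q-p {p} {q} p<q = subst (_< q - p) (+-inverseʳ p) (+-monoˡ-< (- p) p<q)

  divide : ∀ {p q} → 0ℚ < p → 0ℚ < q → ∃[ r ] 0ℚ < r × r * q ≡ p
  divide {p} {q} 0<p 0<q = p * 1/ q
    , 0<* 0<p (positive⁻¹ (1/ q) {{1/pos⇒pos q}})
    , trans (*-assoc p (1/ q) q) (trans (cong (p *_) (*-inverseˡ q)) (*-identityʳ p))
    where
    instance
      q-pos : Positive q
      q-pos = positive 0<q
      q-nonZero : ℚ.NonZero q
      q-nonZero = pos⇒nonZero q

  expand : ∀ a c e → (a + e) * (c + e) ≡ a * c + e * (a + c + e)
  expand = solve 3 (λ a c e → (a :+ e) :* (c :+ e) := a :* c :+ e :* (a :+ c :+ e)) refl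
    where open +-*-Solver

  step : ∀ p k d → p + (1ℚ + k) * d ≡ p + d + k * d
  step p k d = trans
    (cong (p +_) (trans (*-distribʳ-+ d 1ℚ k) (cong (_+ k * d) (*-identityˡ d))))
    (sym (+-assoc p d (k * d)))

  p+[q-p]≡q : ∀ p q → p + (q - p) ≡ q
  p+[q-p]≡q = solve 2 (λ p q → p :+ (q :- p) := q) refl
    where open +-*-Solver

opaque

  product-bound : ∀ {q r s d e} → 0ℚ < s → 0ℚ < d → q + d ≡ r → 0ℚ < e →
                  e * (s + (1ℚ + d)) ≡ d → ∀ a c → a * c ≤ q → a + c < s → (a + e) * (c + e) < r
  product-bound {q} {r} {s} {d} {e} 0<s 0<d q+d≡r 0<e eM≡d a c ac≤q a+c<s =
    subst₂ _<_ (sym (expand a c e)) q+d≡r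
      (+-mono-≤-< ac≤q
        (subst (e * (a + c + e) <_) eM≡d (*-monoʳ-<-pos e {{positive 0<e}} a+c+e<M)))
    where
    M : ℚ
    M = s + (1ℚ + d)
    0<1+d : 0ℚ < 1ℚ + d
    0<1+d = <-trans 0<1 (p<p+q 1ℚ 0<d)
    d<M : d < M
    d<M = subst (_< M) (trans (+-identityˡ (0ℚ + d)) (+-identityˡ d))
      (+-mono-< 0<s (+-monoˡ-< d 0<1))
    0<M : 0ℚ < M
    0<M = <-trans 0<d d<M
    e<1 : e < 1ℚ
    e<1 = *-cancelʳ-<-nonNeg M {{nonNegative (<⇒≤ 0<M)}}
      (subst₂ _<_ (sym eM≡d) (sym (*-identityˡ M)) d<M)
    a+c+e<M : a + c + e < M
    a+c+e<M = +-mono-< a+c<s (<-trans e<1 (p<p+q 1ℚ 0<d))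

opaque

  product-modulus : ∀ {q r s} → q < r → 0ℚ < s → ∃[ ε ] 0ℚ < ε ×
    (∀ a c → a * c ≤ q → a + c < s → (a + ε) * (c + ε) < r)
  product-modulus {q} {r} {s} q<r 0<s with p<q⇒0<q-p q<r
  ... | 0<d with divide 0<d (+-mono-< 0<s (<-trans 0<1 (p<p+q 1ℚ 0<d)))
  ...   | ε , 0<ε , εM≡d =
    ε , 0<ε , product-bound 0<s 0<d (p+[q-p]≡q q r) 0<ε εM≡d

opaque

  fromℕ-suc : ∀ n → fromℕ (suc n) ≡ 1ℚ + fromℕ n
  fromℕ-suc n = toℚᵘ-injective (ℚᵘ.≃-trans
    (ℚᵘ.*≡* (cong (ℤ._* ℤ.+ 1) (cong (λ i → ℤ.+ 1 ℤ.+ i) (sym (ℤ.*-identityʳ (ℤ.+ n))))))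
    (ℚᵘ.≃-sym (toℚᵘ-homo-+ 1ℚ (fromℕ n))))

opaque

  archimedean : ∀ p → ∃[ n ] p ≤ fromℕ n
  archimedean (mkℚ (ℤ.+ n) d _) = n , *≤* (ℤ.*-monoˡ-≤-nonNeg (ℤ.+ n) (ℤ.+≤+ (ℕ.s≤s ℕ.z≤n)))
  archimedean (mkℚ -[1+ n ] d _) = 0 , *≤* ℤ.-≤+

opaque

  lower-upper : ∀ x {q r} → q ∈ lower x → r ∈ upper x → q < r
  lower-upper x {q} {r} l u with <-cmp q r
  ... | tri< q<r _ _ = q<r
  ... | tri≈ _ refl _ = contradiction (l , u) (disjoint x)
  ... | tri> _ _ r<q = contradiction (lower-closed x r<q l , u) (disjoint x)

  lower-closed-≤ : ∀ x {q r} → q ≤ r → r ∈ lower x → q ∈ lower x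
  lower-closed-≤ x q≤r l with lower-open x l
  ... | _ , r<s , l′ = lower-closed x (≤-<-trans q≤r r<s) l′

  upper-closed-≤ : ∀ x {q r} → q ≤ r → q ∈ upper x → r ∈ upper x
  upper-closed-≤ x q≤r u with upper-open x u
  ... | _ , s<q , u′ = upper-closed x (<-≤-trans s<q q≤r) u′

  positive-lower : ∀ (x : ℝ⁺) → ∃[ q ] 0ℚ < q × q ∈ lower (real x)
  positive-lower x = lower-open (real x) (0<real x)

  positive-upper : ∀ (x : ℝ⁺) {r} → r ∈ upper (real x) → 0ℚ < r
  positive-upper x = lower-upper (real x) (0<real x)

opaque

  search : ∀ x {δ} → 0ℚ < δ → ∀ n a → 0ℚ < a → a ∈ lower x → a + fromℕ n * δ ∈ upper x →
           ∃[ b ] 0ℚ < b × b ∈ lower x × b + (δ + δ) ∈ upper x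
  search x {δ} 0<δ zero a 0<a l u =
    contradiction (l , subst (_∈ upper x) a+0≡a u) (disjoint x)
    where
    a+0≡a : a + fromℕ 0 * δ ≡ a
    a+0≡a = trans (cong (a +_) (*-zeroˡ δ)) (+-identityʳ a)
  search x {δ} 0<δ (suc n) a 0<a l u
    with located x (subst (a + δ <_) (+-assoc a δ δ) (p<p+q (a + δ) 0<δ))
  ... | inj₂ u′ = a , 0<a , l , u′
  ... | inj₁ l′ = search x 0<δ n (a + δ) (<-trans 0<a (p<p+q a 0<δ)) l′
                    (subst (_∈ upper x) eq u)
    where
    eq : a + fromℕ (suc n) * δ ≡ a + δ + fromℕ n * δ
    eq = trans (cong (λ k → a + k * δ) (fromℕ-suc n)) (step a (fromℕ n) δ)

  approximate-step : ∀ (x : ℝ⁺) {δ} → 0ℚ < δ →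
                     ∃[ a ] 0ℚ < a × a ∈ lower (real x) × a + (δ + δ) ∈ upper (real x)
  approximate-step x {δ} 0<δ with positive-lower x | upper-inhabited (real x)
  ... | a , 0<a , l | b , u with divide (positive-upper x u) 0<δ
  ...   | t , _ , tδ≡b with archimedean t
  ...     | n , t≤n = search (real x) 0<δ n a 0<a l (upper-closed-≤ (real x) b≤a+nδ u)
    where
    b≤nδ : b ≤ fromℕ n * δ
    b≤nδ = subst (_≤ fromℕ n * δ) tδ≡b
      (*-monoʳ-≤-nonNeg δ {{nonNegative (<⇒≤ 0<δ)}} t≤n)
    b≤a+nδ : b ≤ a + fromℕ n * δ
    b≤a+nδ = subst (_≤ a + fromℕ n * δ) (+-identityˡ b) (+-mono-≤ (<⇒≤ 0<a) b≤nδ)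

opaque

  approximate : ∀ (x : ℝ⁺) {ε} → 0ℚ < ε →
                ∃[ a ] 0ℚ < a × a ∈ lower (real x) × a + ε ∈ upper (real x)
  approximate x {ε} 0<ε with approximate-step x (0<* 0<ε 0<½)
  ... | a , 0<a , l , u = a , 0<a , l , subst (λ e → a + e ∈ upper (real x)) halves u
    where
    halves : ε * ½ + ε * ½ ≡ ε
    halves = trans (sym (*-distribˡ-+ ε ½ ½)) (*-identityʳ ε)

1⁺ : ℝ⁺
1⁺ = record
  { lower           = _< 1ℚ
  ; upper           = 1ℚ <_
  ; lower-inhabited = 0ℚ , 0<1
  ; upper-inhabited = 1ℚ + 1ℚ , p<p+q 1ℚ 0<1
  ; lower-closed    = <-trans
  ; upper-closed    = λ q<r 1<q → <-trans 1<q q<r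
  ; lower-open      = <-dense
  ; upper-open      = λ 1<r → let q , 1<q , q<r = <-dense 1<r in q , q<r , 1<q
  ; disjoint        = λ (q<1 , 1<q) → <-asym q<1 1<q
  ; located         = loc
  } ,⁺ 0<1
  where
  loc : ∀ {q r} → q < r → q < 1ℚ ⊎ 1ℚ < r
  loc {q} q<r with q <? 1ℚ
  ... | yes q<1 = inj₁ q<1
  ... | no  q≮1 = inj₂ (≤-<-trans (≮⇒≥ q≮1) q<r)

-- For positive x and y:  q < x * y  iff  q < r * s for some 0 < r < x, 0 < s < y;
-- x * y < q  iff  r * s < q for some r > x, s > y (then r, s > 0 automatically).

module Product (x y : ℝ⁺) where

  Lower : Pred ℚ 0ℓ
  Lower q = ∃[ r ] ∃[ s ] 0ℚ < r × 0ℚ < s × r ∈ lower (real x) × s ∈ lower (real y) × q < r * s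

  Upper : Pred ℚ 0ℓ
  Upper q = ∃[ r ] ∃[ s ] r ∈ upper (real x) × s ∈ upper (real y) × r * s < q

  0∈Lower : 0ℚ ∈ Lower
  0∈Lower with positive-lower x | positive-lower y
  ... | r , 0<r , lx | s , 0<s , ly = r , s , 0<r , 0<s , lx , ly , 0<* 0<r 0<s

  Upper-inhabited : Satisfiable Upper
  Upper-inhabited with upper-inhabited (real x) | upper-inhabited (real y)
  ... | r , ux | s , uy = r * s + 1ℚ , r , s , ux , uy , p<p+q (r * s) 0<1

  Lower-open : ∀ {q} → q ∈ Lower → ∃[ t ] q < t × t ∈ Lower
  Lower-open (r , s , 0<r , 0<s , lx , ly , q<rs) with <-dense q<rs
  ... | t , q<t , t<rs = t , q<t , r , s , 0<r , 0<s , lx , ly , t<rs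

  Upper-open : ∀ {q} → q ∈ Upper → ∃[ t ] t < q × t ∈ Upper
  Upper-open (r , s , ux , uy , rs<q) with <-dense rs<q
  ... | t , rs<t , t<q = t , t<q , r , s , ux , uy , rs<t

  Disjoint : ∀ {q} → ¬ (q ∈ Lower × q ∈ Upper)
  Disjoint ((r , s , 0<r , 0<s , lx , ly , q<rs) , (r′ , s′ , ux , uy , r′s′<q)) =
    <-asym (<-trans r′s′<q q<rs)
      (*-mono-<-pos 0<r 0<s (lower-upper (real x) lx ux) (lower-upper (real y) ly uy))

  opaque
    Located : ∀ {q r} → q < r → q ∈ Lower ⊎ r ∈ Upper
    Located {q} {r} q<r with upper-inhabited (real x) | upper-inhabited (real y)
    ... | b , ux₀ | d , uy₀ with
      product-modulus q<r (+-mono-< (positive-upper x ux₀) (positive-upper y uy₀))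
    ...   | ε , 0<ε , modulus with approximate x 0<ε | approximate y 0<ε
    ...     | a , 0<a , lx , ux | c , 0<c , ly , uy with q <? a * c
    ...       | yes q<ac = inj₁ (a , c , 0<a , 0<c , lx , ly , q<ac)
    ...       | no  q≮ac = inj₂ (a + ε , c + ε , ux , uy , modulus a c (≮⇒≥ q≮ac)
                             (+-mono-< (lower-upper (real x) lx ux₀) (lower-upper (real y) ly uy₀)))

infixl 7 _*⁺_

_*⁺_ : ℝ⁺ → ℝ⁺ → ℝ⁺
x *⁺ y = record
  { lower           = Lower
  ; upper           = Upper
  ; lower-inhabited = 0ℚ , 0∈Lower
  ; upper-inhabited = Upper-inhabited
  ; lower-closed    = λ { p<q (r , s , 0<r , 0<s , lx , ly , q<rs) →
                          r , s , 0<r , 0<s , lx , ly , <-trans p<q q<rs }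
  ; upper-closed    = λ { p<q (r , s , ux , uy , rs<p) → r , s , ux , uy , <-trans rs<p p<q }
  ; lower-open      = Lower-open
  ; upper-open      = Upper-open
  ; disjoint        = Disjoint
  ; located         = Located
  } ,⁺ 0∈Lower
  where open Product x y

*⁺-1⁺-rawMonoid : RawMonoid (lsuc 0ℓ) 0ℓ
*⁺-1⁺-rawMonoid = record { _≈_ = _≈⁺_ ; _∙_ = _*⁺_ ; ε = 1⁺ }

infixr 8 _^⁺_

_^⁺_ : ℝ⁺ → ℕ → ℝ⁺
x ^⁺ n = n ×⁺ x
  where open RawMonoidDefs *⁺-1⁺-rawMonoid using () renaming (_×_ to _×⁺_)

-- The positive k-th root is the cut in which a rational r > 0 lies below (above)
-- iff r ^ k lies below (above) x; the slack q < r puts all q ≤ 0 below.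

module Root (k : ℕ) .{{_ : NonZero k}} (x : ℝ⁺) where

  Lower : Pred ℚ 0ℓ
  Lower q = ∃[ r ] 0ℚ < r × r ^ k ∈ lower (real x) × q < r

  Upper : Pred ℚ 0ℓ
  Upper q = ∃[ r ] 0ℚ < r × r ^ k ∈ upper (real x) × r < q

  0∈Lower : 0ℚ ∈ Lower
  0∈Lower with positive-lower x
  ... | s , 0<s , l with ≤-total s 1ℚ
  ...   | inj₁ s≤1 = s , 0<s , lower-closed-≤ (real x) (p^n≤p k 0<s s≤1) l , 0<s
  ...   | inj₂ 1≤s = 1ℚ , 0<1
                   , lower-closed-≤ (real x) (subst (_≤ s) (sym (1^n≡1 k)) 1≤s) l
                   , 0<1

  Upper-inhabited : Satisfiable Upper
  Upper-inhabited with upper-inhabited (real x)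
  ... | u , ux = s + 1ℚ , s , <-≤-trans 0<1 (p≤q⊔p u 1ℚ)
               , upper-closed-≤ (real x) (≤-trans (p≤p⊔q u 1ℚ) (p≤p^n k (p≤q⊔p u 1ℚ))) ux
               , p<p+q s 0<1
    where s = u ⊔ 1ℚ

  Lower-open : ∀ {q} → q ∈ Lower → ∃[ t ] q < t × t ∈ Lower
  Lower-open (r , 0<r , l , q<r) with <-dense q<r
  ... | t , q<t , t<r = t , q<t , r , 0<r , l , t<r

  Upper-open : ∀ {q} → q ∈ Upper → ∃[ t ] t < q × t ∈ Upper
  Upper-open (r , 0<r , u , r<q) with <-dense r<q
  ... | t , r<t , t<q = t , t<q , r , 0<r , u , r<t

  Disjoint : ∀ {q} → ¬ (q ∈ Lower × q ∈ Upper)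
  Disjoint ((r , 0<r , l , q<r) , (s , 0<s , u , s<q)) =
    <-asym (lower-upper (real x) l u) (^-monoˡ-<-pos k 0<s (<-trans s<q q<r))

  opaque
    Located : ∀ {q r} → q < r → q ∈ Lower ⊎ r ∈ Upper
    Located {q} {r} q<r with q <? 0ℚ
    ... | yes q<0 = let s , 0<s , l , _ = 0∈Lower in inj₁ (s , 0<s , l , <-trans q<0 0<s)
    ... | no  q≮0 with <-dense q<r
    ...   | q′ , q<q′ , q′<r with <-dense q′<r
    ...     | r′ , q′<r′ , r′<r
      with located (real x) (^-monoˡ-<-pos k (≤-<-trans (≮⇒≥ q≮0) q<q′) q′<r′)
    ...       | inj₁ l = inj₁ (q′ , ≤-<-trans (≮⇒≥ q≮0) q<q′ , l , q<q′)
    ...       | inj₂ u = inj₂ (r′ , <-trans (≤-<-trans (≮⇒≥ q≮0) q<q′) q′<r′ , u , r′<r)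

root : (k : ℕ) .{{_ : NonZero k}} → ℝ⁺ → ℝ⁺
root k x = record
  { lower           = Lower
  ; upper           = Upper
  ; lower-inhabited = 0ℚ , 0∈Lower
  ; upper-inhabited = Upper-inhabited
  ; lower-closed    = λ { p<q (r , 0<r , l , q<r) → r , 0<r , l , <-trans p<q q<r }
  ; upper-closed    = λ { p<q (r , 0<r , u , r<p) → r , 0<r , u , <-trans r<p p<q }
  ; lower-open      = Lower-open
  ; upper-open      = Upper-open
  ; disjoint        = Disjoint
  ; located         = Located
  } ,⁺ 0∈Lower
  where open Root k x

-- The sequence with scaling constant 1, so no factor multiplies the cube root.

g : ℝ⁺ → ℝ⁺ → ℝ⁺ → ℕ → ℝ⁺
g a b c 0 = a
g a b c 1 = b
g a b c 2 = c
g a b c (suc (suc (suc n))) =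
  root 3 (g a b c (suc (suc n)) *⁺ g a b c (suc n) *⁺ g a b c n)

T : ℕ → ℕ
T 0 = 0
T 1 = 0
T 2 = 1
T (suc (suc (suc n))) = T (suc (suc n)) ℕ.+ 3 ℕ.* T (suc n) ℕ.+ 9 ℕ.* T n

{-# OPTIONS --safe #-}

-- In a commutative monoid written multiplicatively, g₍ₙ₊₃₎³ = g₍ₙ₊₂₎ g₍ₙ₊₁₎ gₙ turns into a
-- recurrence for the exponents of g₍ₙ₊₂₎ ^ 3ⁿ, which is the recurrence of T: raising
-- to the power 3ⁿ⁺² weights the three factors by 1, 3 and 9. It remains to see that
-- the positive cuts form a commutative monoid in which root k is inverse to the
-- k-th power. Equality of cuts only has to be checked on lower cuts, by locatedness.

module Submission where

open import Algebra.Bundles using (CommutativeMonoid)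
import Algebra.Properties.CommutativeMonoid.Mult as Mult
import Algebra.Properties.CommutativeSemigroup as CommutativeSemigroupProperties
open import Algebra.Structures.Biased using (isCommutativeMonoidˡ)
open import Data.Nat.Base using (ℕ; zero; suc; NonZero; _+_; _*_; _^_)
open import Data.Nat.Properties using (m^n≢0; *-comm)
open import Data.Nat.Tactic.RingSolver using (solve-∀)
open import Data.Product.Base using (∃-syntax; _×_; _,_; map; zip)
open import Data.Rational.Base as ℚ using (0ℚ; _⊔_)
import Data.Rational.Properties as ℚ
open import Data.Sum.Base using (inj₁; inj₂)
open import Defs using (ℝ⁺; _≈⁺_; _*⁺_; _^⁺_; root; g; T)
open import Defs using
  ( lower; upper; lower-open; upper-open; lower-closed; located; disjoint; real
  ; 1⁺; 0<1; 0<*; 0<^; divide; ^-monoˡ-≤-pos; ^-monoˡ-<-pos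
  ; upper-closed-≤; positive-lower; positive-upper
  ; upper-inhabited )
  renaming (_^_ to _^ℚ_)
open import Level using (0ℓ) renaming (suc to lsuc)
open import Relation.Binary.PropositionalEquality using (_≡_; refl; sym; trans; subst)
import Relation.Binary.Reasoning.Setoid as ≈-Reasoning
open import Relation.Binary.Structures using (IsEquivalence)
open import Relation.Nullary.Negation using (contradiction)
open import Relation.Unary using (_∈_; _⊆_)
open import Relation.Unary.Properties using (≐-refl; ≐-sym; ≐-trans)

module _ {c ℓ} (M : CommutativeMonoid c ℓ) where

  open CommutativeMonoid M
    using (Carrier; _≈_; _∙_; ∙-cong; ∙-congʳ; identityˡ; identityʳ; setoid; commutativeSemigroup)
    renaming (sym to ≈-sym; trans to ≈-trans)
  open CommutativeSemigroupProperties commutativeSemigroup using (interchange)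
  open Mult M using (×-congʳ; ×-congˡ; ×-assocˡ; ×-distrib-+; ×-homo-+) renaming (_×_ to infixr 8 _·_)
  open ≈-Reasoning setoid

  module _ (G : ℕ → Carrier) (rec : ∀ n → 3 · G (3 + n) ≈ G (2 + n) ∙ G (1 + n) ∙ G n) where

    monomial : ℕ → ℕ → ℕ → Carrier
    monomial i j k = i · G 0 ∙ j · G 1 ∙ k · G 2

    monomial-cong-≡ : ∀ i {j j′} k {x} → j ≡ j′ → x ≈ monomial i j k → x ≈ monomial i j′ k
    monomial-cong-≡ i k {x} = subst (λ j → x ≈ monomial i j k)

    monomial-∙ : ∀ i j k i′ j′ k′ →
                 monomial i j k ∙ monomial i′ j′ k′ ≈ monomial (i + i′) (j + j′) (k + k′)
    monomial-∙ i j k i′ j′ k′ = begin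
      monomial i j k ∙ monomial i′ j′ k′
        ≈⟨ interchange _ _ _ _ ⟩
      (i · G 0 ∙ j · G 1) ∙ (i′ · G 0 ∙ j′ · G 1) ∙ (k · G 2 ∙ k′ · G 2)
        ≈⟨ ∙-congʳ (interchange _ _ _ _) ⟩
      (i · G 0 ∙ i′ · G 0) ∙ (j · G 1 ∙ j′ · G 1) ∙ (k · G 2 ∙ k′ · G 2)
        ≈⟨ ∙-cong (∙-cong (×-homo-+ _ i i′) (×-homo-+ _ j j′)) (×-homo-+ _ k k′) ⟨
      monomial (i + i′) (j + j′) (k + k′) ∎

    ·-monomial : ∀ m i j k → m · monomial i j k ≈ monomial (m * i) (m * j) (m * k)
    ·-monomial m i j k = begin
      m · monomial i j k
        ≈⟨ ×-distrib-+ _ _ m ⟩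
      m · (i · G 0 ∙ j · G 1) ∙ m · (k · G 2)
        ≈⟨ ∙-congʳ (×-distrib-+ _ _ m) ⟩
      m · (i · G 0) ∙ m · (j · G 1) ∙ m · (k · G 2)
        ≈⟨ ∙-cong (∙-cong (×-assocˡ _ m i) (×-assocˡ _ m j)) (×-assocˡ _ m k) ⟩
      monomial (m * i) (m * j) (m * k) ∎

    ·-*-monomial : ∀ p m {x} i j k → m · x ≈ monomial i j k →
                   (p * m) · x ≈ monomial (p * i) (p * j) (p * k)
    ·-*-monomial p m {x} i j k eq = begin
      (p * m) · x                       ≈⟨ ×-assocˡ x p m ⟨
      p · (m · x)                       ≈⟨ ×-congʳ p eq ⟩
      p · monomial i j k                ≈⟨ ·-monomial p i j k ⟩
      monomial (p * i) (p * j) (p * k)  ∎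

    rec-monomial : ∀ m n i₂ j₂ k₂ i₁ j₁ k₁ i₀ j₀ k₀ →
      m · G (2 + n) ≈ monomial i₂ j₂ k₂ →
      m · G (1 + n) ≈ monomial i₁ j₁ k₁ →
      m · G n ≈ monomial i₀ j₀ k₀ →
      (3 * m) · G (3 + n) ≈ monomial (i₂ + i₁ + i₀) (j₂ + j₁ + j₀) (k₂ + k₁ + k₀)
    rec-monomial m n i₂ j₂ k₂ i₁ j₁ k₁ i₀ j₀ k₀ eq₂ eq₁ eq₀ = begin
      (3 * m) · G (3 + n)
        ≈⟨ ×-congˡ (*-comm 3 m) ⟩
      (m * 3) · G (3 + n)
        ≈⟨ ×-assocˡ _ m 3 ⟨
      m · (3 · G (3 + n))
        ≈⟨ ×-congʳ m (rec n) ⟩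
      m · (G (2 + n) ∙ G (1 + n) ∙ G n)
        ≈⟨ ×-distrib-+ _ _ m ⟩
      m · (G (2 + n) ∙ G (1 + n)) ∙ m · G n
        ≈⟨ ∙-congʳ (×-distrib-+ _ _ m) ⟩
      m · G (2 + n) ∙ m · G (1 + n) ∙ m · G n
        ≈⟨ ∙-cong (∙-cong eq₂ eq₁) eq₀ ⟩
      monomial i₂ j₂ k₂ ∙ monomial i₁ j₁ k₁ ∙ monomial i₀ j₀ k₀
        ≈⟨ ∙-congʳ (monomial-∙ i₂ j₂ k₂ i₁ j₁ k₁) ⟩
      monomial (i₂ + i₁) (j₂ + j₁) (k₂ + k₁) ∙ monomial i₀ j₀ k₀
        ≈⟨ monomial-∙ (i₂ + i₁) (j₂ + j₁) (k₂ + k₁) i₀ j₀ k₀ ⟩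
      monomial (i₂ + i₁ + i₀) (j₂ + j₁ + j₀) (k₂ + k₁ + k₀) ∎

    G₁-monomial : ∀ j → j · G 1 ≈ monomial 0 j 0
    G₁-monomial j = ≈-sym (≈-trans (identityʳ _) (identityˡ _))

    G₂-monomial : ∀ k → k · G 2 ≈ monomial 0 0 k
    G₂-monomial k = ≈-sym (≈-trans (∙-congʳ (identityˡ _)) (identityˡ _))

    G₀-monomial : ∀ i → i · G 0 ≈ monomial i 0 0
    G₀-monomial i = ≈-sym (≈-trans (identityʳ _) (identityʳ _))

    3^n·G[2+n] : ∀ n → (3 ^ n) · G (2 + n) ≈ monomial (T (1 + n)) (T (1 + n) + 3 * T n) (T (2 + n))
    3^n·G[2+n] 0 = G₂-monomial 1
    3^n·G[2+n] 1 = rec-monomial 1 0 0 0 1 0 1 0 1 0 0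
      (G₂-monomial 1) (G₁-monomial 1) (G₀-monomial 1)
    3^n·G[2+n] 2 = rec-monomial 3 1 1 1 1 0 0 3 0 3 0
      (3^n·G[2+n] 1) (G₂-monomial 3) (G₁-monomial 3)
    3^n·G[2+n] (suc (suc (suc n))) =
      monomial-cong-≡ (T (4 + n)) (T (5 + n)) (exponent-rec (T n) (T (1 + n)) (T (2 + n)))
        (rec-monomial (3 ^ (2 + n)) (2 + n)
          (T (3 + n)) (T (3 + n) + 3 * T (2 + n)) (T (4 + n))
          (3 * T (2 + n)) (3 * (T (2 + n) + 3 * T (1 + n))) (3 * T (3 + n))
          (9 * T (1 + n)) (9 * (T (1 + n) + 3 * T n)) (9 * T (2 + n))
          (3^n·G[2+n] (suc (suc n)))
          (·-*-monomial 3 (3 ^ (1 + n)) (T (2 + n)) (T (2 + n) + 3 * T (1 + n)) (T (3 + n))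
            (3^n·G[2+n] (suc n)))
          (≈-trans (×-congˡ (9*-assoc (3 ^ n)))
            (·-*-monomial 9 (3 ^ n) (T (1 + n)) (T (1 + n) + 3 * T n) (T (2 + n))
              (3^n·G[2+n] n))))
      where
      9*-assoc : ∀ m → 3 * (3 * m) ≡ 9 * m
      9*-assoc = solve-∀
      exponent-rec : ∀ t₀ t₁ t₂ → let t₃ = t₂ + 3 * t₁ + 9 * t₀ in
        (t₃ + 3 * t₂) + 3 * (t₂ + 3 * t₁) + 9 * (t₁ + 3 * t₀) ≡ (t₃ + 3 * t₂ + 9 * t₁) + 3 * t₃
      exponent-rec = solve-∀

⊔-pres-< : ∀ {p q r} → p ℚ.< r → q ℚ.< r → p ⊔ q ℚ.< r
⊔-pres-< {p} {q} {r} p<r q<r with ℚ.⊔-sel p q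
... | inj₁ p⊔q≡p = subst (ℚ._< r) (sym p⊔q≡p) p<r
... | inj₂ p⊔q≡q = subst (ℚ._< r) (sym p⊔q≡q) q<r

0<⇒shrinkʳ : ∀ {q a b} → 0ℚ ℚ.< a → 0ℚ ℚ.< b → q ℚ.< a ℚ.* b →
             ∃[ c ] 0ℚ ℚ.< c × c ℚ.< b × q ℚ.< a ℚ.* c
0<⇒shrinkʳ {q} {a} {b} 0<a 0<b q<ab
  with ℚ.<-dense (⊔-pres-< q<ab (0<* 0<a 0<b))
... | t , q⊔0<t , t<ab with divide (ℚ.≤-<-trans (ℚ.p≤q⊔p q 0ℚ) q⊔0<t) 0<a
...   | c , 0<c , ca≡t =
  c , 0<c
    , ℚ.*-cancelˡ-<-nonNeg a {{ℚ.nonNegative (ℚ.<⇒≤ 0<a)}} (subst (ℚ._< a ℚ.* b) (sym ac≡t) t<ab)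
    , subst (q ℚ.<_) (sym ac≡t) (ℚ.≤-<-trans (ℚ.p≤p⊔q q 0ℚ) q⊔0<t)
  where
  ac≡t : a ℚ.* c ≡ t
  ac≡t = trans (ℚ.*-comm a c) ca≡t

^-cancelʳ-<-pos : ∀ {p q} n → 0ℚ ℚ.< q → p ^ℚ n ℚ.< q ^ℚ n → p ℚ.< q
^-cancelʳ-<-pos n 0<q p^n<q^n =
  ℚ.≰⇒> λ q≤p → ℚ.<-irrefl refl (ℚ.<-≤-trans p^n<q^n (^-monoˡ-≤-pos n 0<q q≤p))

infix 4 _≤⁺_

_≤⁺_ : ℝ⁺ → ℝ⁺ → Set
x ≤⁺ y = lower (real x) ⊆ lower (real y)

≤⁺⇒upper-⊇ : ∀ x y → x ≤⁺ y → upper (real y) ⊆ upper (real x)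
≤⁺⇒upper-⊇ x y x≤y r∈y with upper-open (real y) r∈y
... | q , q<r , q∈y with located (real x) q<r
...   | inj₁ q∈x = contradiction (x≤y q∈x , q∈y) (disjoint (real y))
...   | inj₂ r∈x = r∈x

≤⁺-antisym : ∀ x y → x ≤⁺ y → y ≤⁺ x → x ≈⁺ y
≤⁺-antisym x y x≤y y≤x = (x≤y , y≤x) , (≤⁺⇒upper-⊇ y x y≤x , ≤⁺⇒upper-⊇ x y x≤y)

≈⁺-isEquivalence : IsEquivalence _≈⁺_
≈⁺-isEquivalence = record
  { refl  = ≐-refl , ≐-refl
  ; sym   = map ≐-sym ≐-sym
  ; trans = zip ≐-trans ≐-trans
  }

positive-above : ∀ (x : ℝ⁺) {q} → q ∈ lower (real x) → ∃[ r ] 0ℚ ℚ.< r × q ℚ.< r × r ∈ lower (real x)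
positive-above x {q} q∈x with lower-open (real x) q∈x | positive-lower x
... | r , q<r , r∈x | s , 0<s , s∈x with ℚ.≤-total r s
...   | inj₁ r≤s = s , 0<s , ℚ.<-≤-trans q<r r≤s , s∈x
...   | inj₂ s≤r = r , ℚ.<-≤-trans 0<s s≤r , q<r , r∈x

*⁺-mono-≤⁺ : ∀ x y u v → x ≤⁺ y → u ≤⁺ v → x *⁺ u ≤⁺ y *⁺ v
*⁺-mono-≤⁺ x y u v x≤y u≤v (r , s , 0<r , 0<s , r∈x , s∈u , q<rs) =
  r , s , 0<r , 0<s , x≤y r∈x , u≤v s∈u , q<rs

*⁺-comm-≤⁺ : ∀ x y → x *⁺ y ≤⁺ y *⁺ x
*⁺-comm-≤⁺ x y {q} (r , s , 0<r , 0<s , r∈x , s∈y , q<rs) =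
  s , r , 0<s , 0<r , s∈y , r∈x , subst (q ℚ.<_) (ℚ.*-comm r s) q<rs

*⁺-assoc-≤⁺ : ∀ x y z → (x *⁺ y) *⁺ z ≤⁺ x *⁺ (y *⁺ z)
*⁺-assoc-≤⁺ x y z {q} (p , t , 0<p , 0<t , (r , s , 0<r , 0<s , r∈x , s∈y , p<rs) , t∈z , q<pt) =
  let q<r[st] = subst (q ℚ.<_) (ℚ.*-assoc r s t)
        (ℚ.<-trans q<pt (ℚ.*-monoˡ-<-pos t {{ℚ.positive 0<t}} p<rs))
      u , 0<u , u<st , q<ru = 0<⇒shrinkʳ 0<r (0<* 0<s 0<t) q<r[st]
  in r , u , 0<r , 0<u , r∈x , (s , t , 0<s , 0<t , s∈y , t∈z , u<st) , q<ru

*⁺-identityˡ-≤⁺ : ∀ x → 1⁺ *⁺ x ≤⁺ x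
*⁺-identityˡ-≤⁺ x {q} (r , s , 0<r , 0<s , r<1 , s∈x , q<rs) =
  lower-closed (real x)
    (subst (q ℚ.<_) (ℚ.*-identityˡ s)
      (ℚ.<-trans q<rs (ℚ.*-monoˡ-<-pos s {{ℚ.positive 0<s}} r<1)))
    s∈x

*⁺-identityʳ-≥⁺ : ∀ x → x ≤⁺ x *⁺ 1⁺
*⁺-identityʳ-≥⁺ x {q} q∈x =
  let r , 0<r , q<r , r∈x = positive-above x q∈x
      s , 0<s , s<1 , q<rs = 0<⇒shrinkʳ 0<r 0<1 (subst (q ℚ.<_) (sym (ℚ.*-identityʳ r)) q<r)
  in r , s , 0<r , 0<s , r∈x , s<1 , q<rs

*⁺-cong : ∀ x y u v → x ≈⁺ y → u ≈⁺ v → x *⁺ u ≈⁺ y *⁺ v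
*⁺-cong x y u v ((x≤y , y≤x) , _) ((u≤v , v≤u) , _) = ≤⁺-antisym (x *⁺ u) (y *⁺ v)
  (*⁺-mono-≤⁺ x y u v x≤y u≤v) (*⁺-mono-≤⁺ y x v u y≤x v≤u)

*⁺-comm : ∀ x y → x *⁺ y ≈⁺ y *⁺ x
*⁺-comm x y = ≤⁺-antisym (x *⁺ y) (y *⁺ x) (*⁺-comm-≤⁺ x y) (*⁺-comm-≤⁺ y x)

*⁺-assoc : ∀ x y z → (x *⁺ y) *⁺ z ≈⁺ x *⁺ (y *⁺ z)
*⁺-assoc x y z = ≤⁺-antisym ((x *⁺ y) *⁺ z) (x *⁺ (y *⁺ z)) (*⁺-assoc-≤⁺ x y z)
  λ q∈ → *⁺-comm-≤⁺ z (x *⁺ y)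
    (*⁺-mono-≤⁺ z z (y *⁺ x) (x *⁺ y) (λ q∈z → q∈z) (*⁺-comm-≤⁺ y x)
      (*⁺-assoc-≤⁺ z y x
        (*⁺-mono-≤⁺ (y *⁺ z) (z *⁺ y) x x (*⁺-comm-≤⁺ y z) (λ q∈x → q∈x)
          (*⁺-comm-≤⁺ x (y *⁺ z) q∈))))

*⁺-identityˡ : ∀ x → 1⁺ *⁺ x ≈⁺ x
*⁺-identityˡ x = ≤⁺-antisym (1⁺ *⁺ x) x (*⁺-identityˡ-≤⁺ x)
  λ q∈x → *⁺-comm-≤⁺ x 1⁺ (*⁺-identityʳ-≥⁺ x q∈x)

*⁺-1⁺-commutativeMonoid : CommutativeMonoid (lsuc 0ℓ) 0ℓ
*⁺-1⁺-commutativeMonoid = record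
  { Carrier = ℝ⁺
  ; _≈_     = _≈⁺_
  ; _∙_     = _*⁺_
  ; ε       = 1⁺
  ; isCommutativeMonoid = isCommutativeMonoidˡ record
    { isSemigroup = record
      { isMagma = record
        { isEquivalence = ≈⁺-isEquivalence
        ; ∙-cong        = λ {x y u v} → *⁺-cong x y u v
        }
      ; assoc = *⁺-assoc
      }
    ; identityˡ = *⁺-identityˡ
    ; comm      = *⁺-comm
    }
  }

^⁺-lower⁺ : ∀ k (x : ℝ⁺) {q r} → 0ℚ ℚ.< r → r ∈ lower (real x) → q ℚ.< r ^ℚ k →
            q ∈ lower (real (x ^⁺ k))
^⁺-lower⁺ zero    x 0<r r∈x q<1 = q<1
^⁺-lower⁺ (suc k) x {q} {r} 0<r r∈x q<r^k =
  let s , 0<s , s<r^k , q<rs = 0<⇒shrinkʳ 0<r (0<^ k 0<r) q<r^k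
  in r , s , 0<r , 0<s , r∈x , ^⁺-lower⁺ k x 0<r r∈x s<r^k , q<rs

^⁺-lower⁻ : ∀ k (x : ℝ⁺) {q} → q ∈ lower (real (x ^⁺ k)) →
            ∃[ r ] 0ℚ ℚ.< r × r ∈ lower (real x) × q ℚ.< r ^ℚ k
^⁺-lower⁻ zero x q<1 with positive-lower x
... | r , 0<r , r∈x = r , 0<r , r∈x , q<1
^⁺-lower⁻ (suc k) x (r , s , 0<r , 0<s , r∈x , s∈x^k , q<rs) with ^⁺-lower⁻ k x s∈x^k
... | r′ , 0<r′ , r′∈x , s<r′^k with ℚ.≤-total r r′
...   | inj₁ r≤r′ = r′ , 0<r′ , r′∈x , ℚ.<-≤-trans q<rs (ℚ.≤-trans
          (ℚ.*-monoʳ-≤-nonNeg s {{ℚ.nonNegative (ℚ.<⇒≤ 0<s)}} r≤r′)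
          (ℚ.*-monoˡ-≤-nonNeg r′ {{ℚ.nonNegative (ℚ.<⇒≤ 0<r′)}} (ℚ.<⇒≤ s<r′^k)))
...   | inj₂ r′≤r = r , 0<r , r∈x , ℚ.<-≤-trans q<rs
          (ℚ.*-monoˡ-≤-nonNeg r {{ℚ.nonNegative (ℚ.<⇒≤ 0<r)}}
            (ℚ.≤-trans (ℚ.<⇒≤ s<r′^k) (^-monoˡ-≤-pos k 0<r′ r′≤r)))

^⁺-upper⁻ : ∀ k (x : ℝ⁺) {q} → q ∈ upper (real (x ^⁺ k)) →
            ∃[ r ] r ∈ upper (real x) × r ^ℚ k ℚ.< q
^⁺-upper⁻ zero x 1<q with upper-inhabited (real x)
... | r , r∈x = r , r∈x , 1<q
^⁺-upper⁻ (suc k) x (r , s , r∈x , s∈x^k , rs<q) with ^⁺-upper⁻ k x s∈x^k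
... | r′ , r′∈x , r′^k<s with ℚ.≤-total r r′
...   | inj₁ r≤r′ = r , r∈x , ℚ.≤-<-trans
          (ℚ.*-monoˡ-≤-nonNeg r {{ℚ.nonNegative (ℚ.<⇒≤ (positive-upper x r∈x))}}
            (ℚ.≤-trans (^-monoˡ-≤-pos k (positive-upper x r∈x) r≤r′) (ℚ.<⇒≤ r′^k<s)))
          rs<q
...   | inj₂ r′≤r = r′ , r′∈x , ℚ.≤-<-trans (ℚ.≤-trans
          (ℚ.*-monoˡ-≤-nonNeg r′ {{ℚ.nonNegative (ℚ.<⇒≤ (positive-upper x r′∈x))}} (ℚ.<⇒≤ r′^k<s))
          (ℚ.*-monoʳ-≤-nonNeg s
            {{ℚ.nonNegative (ℚ.<⇒≤ (positive-upper (x ^⁺ k) s∈x^k))}} r′≤r))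
          rs<q

module _ (k : ℕ) .{{_ : NonZero k}} where

  root-mono-≤⁺ : ∀ x y → x ≤⁺ y → root k x ≤⁺ root k y
  root-mono-≤⁺ x y x≤y (r , 0<r , r^k∈x , q<r) = r , 0<r , x≤y r^k∈x , q<r

  root-cong : ∀ x y → x ≈⁺ y → root k x ≈⁺ root k y
  root-cong x y ((x≤y , y≤x) , _) =
    ≤⁺-antisym (root k x) (root k y) (root-mono-≤⁺ x y x≤y) (root-mono-≤⁺ y x y≤x)

  root-^⁺ : ∀ x → root k (x ^⁺ k) ≈⁺ x
  root-^⁺ x = ≤⁺-antisym (root k (x ^⁺ k)) x root≤ ≤root
    where
    root≤ : root k (x ^⁺ k) ≤⁺ x
    root≤ (r , 0<r , r^k∈x^k , q<r) with ^⁺-lower⁻ k x r^k∈x^k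
    ... | s , 0<s , s∈x , r^k<s^k =
      lower-closed (real x) (ℚ.<-trans q<r (^-cancelʳ-<-pos k 0<s r^k<s^k)) s∈x
    ≤root : x ≤⁺ root k (x ^⁺ k)
    ≤root q∈x with positive-above x q∈x
    ... | r , 0<r , q<r , r∈x with lower-open (real x) r∈x
    ...   | s , r<s , s∈x =
      r , 0<r , ^⁺-lower⁺ k x (ℚ.<-trans 0<r r<s) s∈x (^-monoˡ-<-pos k 0<r r<s) , q<r

  -- Locatedness of the power replaces the density of k-th powers in ≤root^.
  root^⁺ : ∀ x → root k x ^⁺ k ≈⁺ x
  root^⁺ x = ≤⁺-antisym (root k x ^⁺ k) x root^≤ ≤root^
    where
    root^≤ : root k x ^⁺ k ≤⁺ x
    root^≤ q∈ with ^⁺-lower⁻ k (root k x) q∈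
    ... | r , 0<r , (s , 0<s , s^k∈x , r<s) , q<r^k =
      lower-closed (real x) (ℚ.<-trans q<r^k (^-monoˡ-<-pos k 0<r r<s)) s^k∈x
    ≤root^ : x ≤⁺ root k x ^⁺ k
    ≤root^ q∈x with lower-open (real x) q∈x
    ... | p , q<p , p∈x with located (real (root k x ^⁺ k)) q<p
    ...   | inj₁ q∈ = q∈
    ...   | inj₂ p∈ with ^⁺-upper⁻ k (root k x) p∈
    ...     | r , (s , 0<s , s^k∈x , s<r) , r^k<p =
      contradiction
        (p∈x , upper-closed-≤ (real x) (ℚ.<⇒≤ (ℚ.<-trans (^-monoˡ-<-pos k 0<s s<r) r^k<p)) s^k∈x)
        (disjoint (real x))

lemma2p2 : (a b c : ℝ⁺) (n : ℕ) →
    g a b c (2 + n) ≈⁺ root (3 ^ n) {{m^n≢0 3 n}}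
    (a ^⁺ T (1 + n) *⁺ b ^⁺ (T (1 + n) + 3 * T n) *⁺ c ^⁺ T (2 + n))
lemma2p2 a b c n = begin
  y                          ≈⟨ root-^⁺ (3 ^ n) y ⟨
  root (3 ^ n) (y ^⁺ 3 ^ n)  ≈⟨ root-cong (3 ^ n) (y ^⁺ 3 ^ n) z y^3^n≈z ⟩
  root (3 ^ n) z             ∎
  where
  instance
    3^n≢0 : NonZero (3 ^ n)
    3^n≢0 = m^n≢0 3 n
  open ≈-Reasoning (CommutativeMonoid.setoid *⁺-1⁺-commutativeMonoid)
  y z : ℝ⁺
  y = g a b c (2 + n)
  z = a ^⁺ T (1 + n) *⁺ b ^⁺ (T (1 + n) + 3 * T n) *⁺ c ^⁺ T (2 + n)
  y^3^n≈z : y ^⁺ 3 ^ n ≈⁺ z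
  y^3^n≈z = 3^n·G[2+n] *⁺-1⁺-commutativeMonoid (g a b c)
    (λ m → root^⁺ 3 (g a b c (2 + m) *⁺ g a b c (1 + m) *⁺ g a b c m)) n
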